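{- Let $n$ be a positive integer such that $n = 11q_1+2$ with $q_1\geq 5$, or $n=11q_2+5$ with $q_2\geq 3$, or $n = 11q_3+8$ with $q_3 \geq 1$. Then $\gamma^{ID}(C_n(1,3)) \geq \lceil 4n/11\rceil + 1$.
   Context: For a positive integer $n$, the circulant graph $C_n(1,3)$ has vertex set $\mathbb{Z}_n$, and $u$ is adjacent to $u\pm1$ and $u\pm 3$ (modulo $n$); $N[u]=\{u,u\pm1,u\pm3\}$. For a code (nonempty subset) $C\subseteq\mathbb{Z}_n$, $I(C;u)=N[u]\cap C$. $C$ is identifying if $I(C;u)\neq\emptyset$ for all $u$ and $I(C;u)\ne I(C;v)$ for all distinct $u,v$. $\gamma^{ID}(G)$ is the minimum cardinality of an identifying code in $G$. -}

module Defs where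

open import Data.Nat using (ℕ; suc; _+_; _*_; _∸_; _%_; _/_; _≡ᵇ_; NonZero)
open import Data.Bool using (Bool; true; false; _∨_; _∧_)
open import Data.Fin using (Fin; toℕ)
open import Data.Fin.Subset using (Subset; _∈_; Nonempty; ∣_∣)
open import Data.Vec using (tabulate; lookup)
open import Relation.Binary.PropositionalEquality using (_≡_; _≢_)
open import Data.Product using (_×_)

offset : (n : ℕ) .{{_ : NonZero n}} → Fin n → Fin n → ℕ
offset n u v = (toℕ v + n ∸ toℕ u) % n

-- v ∈ N[u] in C_n(1,3):  v - u ∈ {0, 1, -1, 3, -3} (mod n)
adj? : (n : ℕ) .{{_ : NonZero n}} → Fin n → Fin n → Bool
adj? n u v =
  (offset n u v ≡ᵇ 0) ∨ (offset n u v ≡ᵇ 1) ∨ (offset n u v ≡ᵇ 3)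
  ∨ (offset n v u ≡ᵇ 1) ∨ (offset n v u ≡ᵇ 3)

N[_] : {n : ℕ} .{{_ : NonZero n}} → Fin n → Subset n
N[_] {n} u = tabulate (λ v → adj? n u v)

I : {n : ℕ} .{{_ : NonZero n}} → Subset n → Fin n → Subset n
I {n} C u = tabulate (λ v → adj? n u v ∧ lookup C v)

-- identifying code in C_n(1,3) (nonempty follows from the first condition)
IsIdentifying : (n : ℕ) .{{_ : NonZero n}} → Subset n → Set
IsIdentifying n C =
  ((u : Fin n) → Nonempty (I C u)) × ((u v : Fin n) → u ≢ v → I C u ≢ I C v)

⌈_/_⌉ : ℕ → (b : ℕ) .{{_ : NonZero b}} → ℕ
⌈ a / b ⌉ = (a + b ∸ 1) / b

{-# OPTIONS --safe #-}
-- Read the code as a cyclic binary word.  Give a position whose next ten letters do not occur in the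
-- word (00000110011)^∞ the penalty 1, give one that leaves that word the penalty 43, and all others 0.
-- A potential on the 12-letter words, found by value iteration and checked on all 13-letter words that
-- an identifying code can contain, shows 154 ∣C∣ ≥ 56 n + (sum of the penalties).  If ∣C∣ ≤ ⌈4n/11⌉,
-- then the penalties sum to at most 42 and to less than n, so the cyclic word never leaves
-- (00000110011)^∞ and is not everywhere outside it.  It therefore stays inside, where the potential is
-- tight, so 11 ∣C∣ = 4 n, which is impossible because 11 does not divide n.
module Submission where

open import Defs
open import Data.Bool using (Bool; true; false; _∧_; _∨_; T; T?; if_then_else_)
open import Data.Bool.ListAction using (any; all)
open import Data.Bool.Properties using (T-≡; T-∧; T-∨; ⇔→≡)
open import Data.Empty using (⊥-elim)
open import Data.Fin as Fin using (Fin; toℕ)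
open import Data.Fin.Properties using (toℕ-injective; toℕ-fromℕ<; toℕ<n)
open import Data.Fin.Subset using (Subset; ∣_∣)
open import Data.List using (List; []; _∷_; map; filter; _++_)
open import Data.List.Membership.DecPropositional using (_∈?_)
open import Data.List.Membership.Propositional using (find; lose)
open import Data.List.Membership.Propositional.Properties using (∈-filter⁺)
open import Data.List.Relation.Unary.All using ([]; _∷_)
open import Data.List.Relation.Unary.All.Properties using (all⁻)
open import Data.List.Relation.Unary.Any as Any using (Any; here; there; any?)
open import Data.List.Relation.Unary.Any.Properties using (any⁺; map⁺; map⁻; ++⁺ˡ; ++⁺ʳ)
open import Data.Maybe using (Maybe; just; nothing)
open import Data.Nat
open import Data.Nat.Divisibility using (n∣m*n)
open import Data.Nat.DivMod
open import Data.Nat.GeneralisedArithmetic using (fold)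
open import Data.Nat.Properties
open import Data.Nat.Tactic.RingSolver using (solve-∀)
open import Data.Product using (Σ; _×_; _,_; proj₁; proj₂)
open import Data.Sum using (_⊎_; inj₁; inj₂)
open import Data.Vec using (Vec; []; _∷_; lookup; tail; take)
open import Data.Vec.Properties using (lookup∘tabulate; tabulate-cong; []=⇒lookup)
open import Function using (_∘_; _⇔_; mk⇔; Equivalence)
open import Relation.Binary.PropositionalEquality
open import Relation.Nullary using (yes; no; ¬_; ¬?)
open import Relation.Nullary.Decidable using (True; toWitness)
open Equivalence using (to; from)
open import Algebra.Properties.Semiring.Sum +-*-semiring
  using (sum; sum-syntax; ∑-distrib-+; *-distribˡ-sum; sum-cong-≗)

-- Binary words and the local conditions of an identifying code

bit : ∀ {m} → Vec Bool m → ℕ → Bool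
bit []       k       = false
bit (b ∷ bs) zero    = b
bit (b ∷ bs) (suc k) = bit bs k

value : Bool → ℕ
value b = if b then 1 else 0

-- The ball around 3 and its symmetric differences with its translates by d = 1, 2, 3, 4, 6; for
-- d = 5 and d ≥ 7 the translate is disjoint from the ball.  These are ball and ballDifference d
-- below, in normal form because they are read for each of the 2¹³ words.
supports : List (List ℕ)
supports =
    (0 ∷ 2 ∷ 3 ∷ 4 ∷ 6 ∷ [])
  ∷ (0 ∷ 2 ∷ 6 ∷ 1 ∷ 5 ∷ 7 ∷ [])
  ∷ (0 ∷ 3 ∷ 5 ∷ 8 ∷ [])
  ∷ (0 ∷ 2 ∷ 4 ∷ 5 ∷ 7 ∷ 9 ∷ [])
  ∷ (0 ∷ 2 ∷ 3 ∷ 7 ∷ 8 ∷ 10 ∷ [])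
  ∷ (0 ∷ 2 ∷ 3 ∷ 4 ∷ 8 ∷ 9 ∷ 10 ∷ 12 ∷ [])
  ∷ []

admissible : ∀ {m} → Vec Bool m → Bool
admissible w = all (any (bit w)) supports

pattern ○ = false
pattern ● = true

-- The factors of (00000110011)^∞.
periodic₁₀ : Vec Bool 10 → Bool
periodic₁₀ (○ ∷ ○ ∷ ○ ∷ ○ ∷ ○ ∷ ● ∷ ● ∷ ○ ∷ ○ ∷ ● ∷ []) = true
periodic₁₀ (○ ∷ ○ ∷ ○ ∷ ○ ∷ ● ∷ ● ∷ ○ ∷ ○ ∷ ● ∷ ● ∷ []) = true
periodic₁₀ (○ ∷ ○ ∷ ○ ∷ ● ∷ ● ∷ ○ ∷ ○ ∷ ● ∷ ● ∷ ○ ∷ []) = true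
periodic₁₀ (○ ∷ ○ ∷ ● ∷ ● ∷ ○ ∷ ○ ∷ ● ∷ ● ∷ ○ ∷ ○ ∷ []) = true
periodic₁₀ (○ ∷ ● ∷ ● ∷ ○ ∷ ○ ∷ ● ∷ ● ∷ ○ ∷ ○ ∷ ○ ∷ []) = true
periodic₁₀ (● ∷ ● ∷ ○ ∷ ○ ∷ ● ∷ ● ∷ ○ ∷ ○ ∷ ○ ∷ ○ ∷ []) = true
periodic₁₀ (● ∷ ○ ∷ ○ ∷ ● ∷ ● ∷ ○ ∷ ○ ∷ ○ ∷ ○ ∷ ○ ∷ []) = true
periodic₁₀ (○ ∷ ○ ∷ ● ∷ ● ∷ ○ ∷ ○ ∷ ○ ∷ ○ ∷ ○ ∷ ● ∷ []) = true
periodic₁₀ (○ ∷ ● ∷ ● ∷ ○ ∷ ○ ∷ ○ ∷ ○ ∷ ○ ∷ ● ∷ ● ∷ []) = true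
periodic₁₀ (● ∷ ● ∷ ○ ∷ ○ ∷ ○ ∷ ○ ∷ ○ ∷ ● ∷ ● ∷ ○ ∷ []) = true
periodic₁₀ (● ∷ ○ ∷ ○ ∷ ○ ∷ ○ ∷ ○ ∷ ● ∷ ● ∷ ○ ∷ ○ ∷ []) = true
periodic₁₀ _ = false

periodic : ∀ {m} → Vec Bool (10 + m) → Bool
periodic w = periodic₁₀ (take 10 w)

-- 43 is one more than 42, the largest slack `p` in the three residue classes, so a single exit is
-- already too expensive.
penalty : Bool → Bool → ℕ
penalty z z′ = if z then (if z′ then 0 else 43) else 1

-- Tabulated potential and its verification

Trie : Set → ℕ → Set
Trie A zero    = A
Trie A (suc m) = Trie A m × Trie A m

build : ∀ {A} m → (Vec Bool m → A) → Trie A m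
build zero    f = f []
build (suc m) f = build m (λ v → f (false ∷ v)) , build m (λ v → f (true ∷ v))

at : ∀ {A m} → Trie A m → Vec Bool m → A
at a       []          = a
at (l , r) (false ∷ w) = at l w
at (l , r) (true  ∷ w) = at r w

gain : Vec Bool 13 → Maybe ℕ
gain w = if admissible w then just (56 + penalty (periodic w) (periodic (tail w))) else nothing

-- Value iteration on the graph whose edges lead from the first to the last 12 letters of an admissible
-- word: an edge earns its gain and pays 154 = 14 · 11 if its first letter is 1.  After k rounds a leaf
-- holds the largest profit of a walk of at most k edges.  The empty walk has profit 0, so truncated
-- subtraction loses nothing.  Cycles have no positive profit, and 40 rounds reach the fixed point.
profit : ℕ → Maybe ℕ → ℕ → ℕ
profit cost nothing  e = 0
profit cost (just g) e = g + e ∸ cost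

-- The edges out of a 12-letter word differ only in the appended letter. This is the deepest level
-- of both tries, so the maximum is taken at the leaves.
merge : ∀ m → ℕ → Trie (Maybe ℕ) (suc m) → Trie ℕ (suc m) → Trie ℕ m
merge zero    cost (f , g) (x , y) = profit cost f x ⊔′ profit cost g y
merge (suc m) cost (f , g) (x , y) = merge m cost f x , merge m cost g y

improve : Trie (Maybe ℕ) 13 → Trie ℕ 12 → Trie ℕ 12
improve (f , g) t = merge 11 0 f t , merge 11 154 g t

potential : Trie ℕ 12
potential = iterate (build 13 gain)
  where
  -- A function of the gains, so that their trie is evaluated once and shared by all rounds.
  iterate : Trie (Maybe ℕ) 13 → Trie ℕ 12
  iterate g = fold (build 12 (λ _ → 0)) (improve g) 40

-- Four successive periodic positions make all 13 letters a factor of (00000110011)^∞.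
check : Trie ℕ 12 → Vec Bool 13 → Bool
check t w = if admissible w
  then (56 + penalty (periodic w) (periodic (tail w)) + at t (tail w) ≤ᵇ 154 * value (bit w 0) + at t (take 12 w))
     ∧ (if periodic w ∧ periodic (tail w) ∧ periodic (tail (tail w)) ∧ periodic (tail (tail (tail w)))
        then 154 * value (bit w 0) + at t (take 12 w) ≤ᵇ 56 + at t (tail w) else true)
  else true

every : ∀ m → (Vec Bool m → Bool) → Bool
every zero    p = p []
every (suc m) p = every m (λ v → p (false ∷ v)) ∧ every m (λ v → p (true ∷ v))

verify : Trie ℕ 12 → Bool
verify t = every 13 (check t)

-- `verify potential` evaluates to `true`, so the certificate has the unit type and `_` is solved.
-- The argument below is stated for an arbitrary verified trie.
verifiedPotential : Σ (Trie ℕ 12) (T ∘ verify)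
verifiedPotential = potential , _

every-sound : ∀ m p → T (every m p) → ∀ w → T (p w)
every-sound zero    p ok []          = ok
every-sound (suc m) p ok (false ∷ w) = every-sound m (p ∘ (false ∷_)) (proj₁ (to T-∧ ok)) w
every-sound (suc m) p ok (true  ∷ w) = every-sound m (p ∘ (true ∷_)) (proj₂ (to (T-∧ {every m (p ∘ (false ∷_))}) ok)) w

if-then-sound : ∀ b {b′} → T (if b then b′ else true) → T b → T b′
if-then-sound true ok _ = ok

-- Finite sums

sum-const : ∀ n k → ∑[ i < n ] k ≡ n * k
sum-const zero    k = refl
sum-const (suc n) k = cong (k +_) (sum-const n k)

sum-mono-≤ : ∀ {n} {f g : Fin n → ℕ} → (∀ i → f i ≤ g i) → sum f ≤ sum g
sum-mono-≤ {zero}  f≤g = z≤n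
sum-mono-≤ {suc n} f≤g = +-mono-≤ (f≤g Fin.zero) (sum-mono-≤ (f≤g ∘ Fin.suc))

term≤sum : ∀ {n} (f : Fin n → ℕ) i → f i ≤ sum f
term≤sum f Fin.zero    = m≤m+n _ _
term≤sum f (Fin.suc i) = ≤-trans (term≤sum (f ∘ Fin.suc) i) (m≤n+m _ _)

sum-rotate : ∀ n (φ : ℕ → ℕ) → φ 0 + ∑[ i < n ] φ (suc (toℕ i)) ≡ ∑[ i < n ] φ (toℕ i) + φ n
sum-rotate zero    φ = +-comm (φ 0) 0
sum-rotate (suc n) φ = trans (cong (φ 0 +_) (sum-rotate n (φ ∘ suc))) (sym (+-assoc (φ 0) _ _))

-- Telescoping round the cycle: `f` and `g` will be the potential at successive positions, in one
-- order or the other.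
sum-cancel-≤ : ∀ {n} (x y f g : Fin n → ℕ) → sum f ≡ sum g →
               (∀ i → x i + f i ≤ y i + g i) → sum x ≤ sum y
sum-cancel-≤ x y f g f≡g step = +-cancelʳ-≤ (sum f) (sum x) (sum y) (begin
  sum x + sum f         ≡⟨ ∑-distrib-+ x f ⟨
  sum (λ i → x i + f i) ≤⟨ sum-mono-≤ step ⟩
  sum (λ i → y i + g i) ≡⟨ ∑-distrib-+ y g ⟩
  sum y + sum g         ≡⟨ cong (sum y +_) f≡g ⟨
  sum y + sum f         ∎)
  where open ≤-Reasoning

∣∣-sum : ∀ {n} (C : Subset n) → ∣ C ∣ ≡ sum (value ∘ lookup C)
∣∣-sum []          = refl
∣∣-sum (false ∷ C) = ∣∣-sum C
∣∣-sum (true  ∷ C) = cong suc (∣∣-sum C)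

penalty≤42⇒stays : ∀ b {b′} → penalty b b′ ≤ 42 → T b → T b′
penalty≤42⇒stays true {true}  _  _ = _
penalty≤42⇒stays true {false} le _ = <-irrefl refl le

outside⇒penalty≡1 : ∀ b {b′} → ¬ T b → penalty b b′ ≡ 1
outside⇒penalty≡1 false _   = refl
outside⇒penalty≡1 true  out = ⊥-elim (out _)

word : (ℕ → Bool) → ∀ m → ℕ → Vec Bool m
word c zero    i = []
word c (suc m) i = c i ∷ word c m (suc i)

-- Congruences and offsets modulo n

module _ (n : ℕ) .{{_ : NonZero n}} where

  %-+-congˡ : ∀ d {a b} → a % n ≡ b % n → (d + a) % n ≡ (d + b) % n
  %-+-congˡ d {a} {b} a≡b = begin
    (d + a) % n         ≡⟨ %-distribˡ-+ d a n ⟩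
    (d % n + a % n) % n ≡⟨ cong (λ r → (d % n + r) % n) a≡b ⟩
    (d % n + b % n) % n ≡⟨ %-distribˡ-+ d b n ⟨
    (d + b) % n         ∎
    where open ≡-Reasoning

  %-+-cancelˡ : ∀ d {a b} → (d + a) % n ≡ (d + b) % n → a % n ≡ b % n
  %-+-cancelˡ d {a} {b} d+a≡d+b =
    -- `d * n ∸ d` acts as the negative of `d`, since `n` is positive.
    trans (sym (undo a)) (trans (%-+-congˡ (d * n ∸ d) d+a≡d+b) (undo b))
    where
    open ≡-Reasoning
    undo : ∀ x → (d * n ∸ d + (d + x)) % n ≡ x % n
    undo x = begin
      (d * n ∸ d + (d + x)) % n ≡⟨ cong (_% n) (+-assoc (d * n ∸ d) d x) ⟨
      (d * n ∸ d + d + x) % n   ≡⟨ cong (λ e → (e + x) % n) (m∸n+n≡m (m≤m*n d n)) ⟩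
      (d * n + x) % n           ≡⟨ %-remove-+ˡ x (n∣m*n d) ⟩
      x % n                     ∎

  toℕ-mod : ∀ x → toℕ (x mod n) ≡ x % n
  toℕ-mod x = toℕ-fromℕ< (m%n<n x n)

  mod-cong : ∀ {x y} → x % n ≡ y % n → x mod n ≡ y mod n
  mod-cong {x} {y} x≡y = toℕ-injective (trans (toℕ-mod x) (trans x≡y (sym (toℕ-mod y))))

  mod-toℕ : ∀ (u : Fin n) → toℕ u mod n ≡ u
  mod-toℕ u = toℕ-injective (trans (toℕ-mod (toℕ u)) (m<n⇒m%n≡m (toℕ<n u)))

  -- Adding `n` before subtracting keeps `∸` from truncating, so `offset` is a true difference
  -- modulo `n`.
  offset-spec : ∀ x y → (offset n (x mod n) (y mod n) + x) % n ≡ y % n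
  offset-spec x y = begin
    (offset n u v + x) % n ≡⟨ %-+-congˡ (offset n u v) x≡u ⟩
    (o % n + toℕ u) % n    ≡⟨ cong (_% n) (+-comm (o % n) (toℕ u)) ⟩
    (toℕ u + o % n) % n    ≡⟨ %-+-congˡ (toℕ u) (m%n%n≡m%n o n) ⟩
    (toℕ u + o) % n        ≡⟨ cong (_% n) (m+[n∸m]≡n u≤v+n) ⟩
    (toℕ v + n) % n        ≡⟨ [m+n]%n≡m%n (toℕ v) n ⟩
    toℕ v % n              ≡⟨ cong (_% n) (toℕ-mod y) ⟩
    y % n % n              ≡⟨ m%n%n≡m%n y n ⟩
    y % n                  ∎
    where
    open ≡-Reasoning
    u = x mod n
    v = y mod n
    o = toℕ v + n ∸ toℕ u
    x≡u : x % n ≡ toℕ u % n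
    x≡u = trans (sym (m%n%n≡m%n x n)) (cong (_% n) (sym (toℕ-mod x)))
    u≤v+n : toℕ u ≤ toℕ v + n
    u≤v+n = ≤-trans (<⇒≤ (toℕ<n u)) (m≤n+m n (toℕ v))

  offset⇒% : ∀ x y {d} → T (offset n (x mod n) (y mod n) ≡ᵇ d) → (d + x) % n ≡ y % n
  offset⇒% x y {d} eq =
    subst (λ o → (o + x) % n ≡ y % n) (≡ᵇ⇒≡ (offset n (x mod n) (y mod n)) d eq) (offset-spec x y)

  %⇒offset : ∀ x y {d} → d < n → (d + x) % n ≡ y % n → T (offset n (x mod n) (y mod n) ≡ᵇ d)
  %⇒offset x y {d} d<n d+x≡y = ≡⇒≡ᵇ o d (begin
    o     ≡⟨ m%n%n≡m%n (toℕ (y mod n) + n ∸ toℕ (x mod n)) n ⟨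
    o % n ≡⟨ %-+-cancelˡ x x+o≡x+d ⟩
    d % n ≡⟨ m<n⇒m%n≡m d<n ⟩
    d     ∎)
    where
    open ≡-Reasoning
    o = offset n (x mod n) (y mod n)
    x+o≡x+d : (x + o) % n ≡ (x + d) % n
    x+o≡x+d = begin
      (x + o) % n ≡⟨ cong (_% n) (+-comm x o) ⟩
      (o + x) % n ≡⟨ offset-spec x y ⟩
      y % n       ≡⟨ d+x≡y ⟨
      (d + x) % n ≡⟨ cong (_% n) (+-comm d x) ⟩
      (x + d) % n ∎

-- Balls, separation and admissible windows

-- The closed neighbourhood of 3 in the infinite graph; that of 3 + i is its translate by i.
ball : List ℕ
ball = 0 ∷ 2 ∷ 3 ∷ 4 ∷ 6 ∷ []

_∖_ : List ℕ → List ℕ → List ℕ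
xs ∖ ys = filter (λ k → ¬? (_∈?_ _≟_ k ys)) xs

ballDifference : ℕ → List ℕ
ballDifference d = ball ∖ map (d +_) ball ++ map (d +_) ball ∖ ball

module _ {n : ℕ} .{{_ : NonZero n}} (6<n : 6 < n) where

  Meets : List ℕ → ℕ → ℕ → Set
  Meets ks i y = Any (λ k → (k + i) % n ≡ y % n) ks

  -- Centring at `3 + i` avoids negative numbers: the offsets 0, 1, 3 become 3, 4, 6, and the
  -- backward offsets 1, 3 become 2, 0.
  adj⇒ball : ∀ i y → T (adj? n ((3 + i) mod n) (y mod n)) → Meets ball i y
  adj⇒ball i y adj with to T-∨ adj
  ... | inj₁ o = there (there (here (offset⇒% n (3 + i) y o)))
  ... | inj₂ adj with to T-∨ adj
  ... | inj₁ o = there (there (there (here (offset⇒% n (3 + i) y o))))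
  ... | inj₂ adj with to T-∨ adj
  ... | inj₁ o = there (there (there (there (here (offset⇒% n (3 + i) y o)))))
  ... | inj₂ adj with to T-∨ adj
  ... | inj₁ o = there (here (sym (%-+-cancelˡ n 1 (offset⇒% n y (3 + i) o))))
  ... | inj₂ o = here (sym (%-+-cancelˡ n 3 (offset⇒% n y (3 + i) o)))

  ball⇒adj : ∀ i y → Meets ball i y → T (adj? n ((3 + i) mod n) (y mod n))
  ball⇒adj i y = λ where
      (here e)                                 → right (fwd 0) (right (fwd 1) (right (fwd 3) (right (bwd 1) (backwards (%-+-congˡ n 3 e)))))
      (there (here e))                         → right (fwd 0) (right (fwd 1) (right (fwd 3) (left (bwd 1) (backwards (%-+-congˡ n 1 e)))))
      (there (there (here e)))                 → left (fwd 0) (forwards e)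
      (there (there (there (here e))))         → right (fwd 0) (left (fwd 1) (forwards e))
      (there (there (there (there (here e))))) → right (fwd 0) (right (fwd 1) (left (fwd 3) (forwards e)))
    where
    fwd bwd : ℕ → Bool
    fwd d = offset n ((3 + i) mod n) (y mod n) ≡ᵇ d
    bwd d = offset n (y mod n) ((3 + i) mod n) ≡ᵇ d
    forwards : ∀ {d} {d≤6 : True (d ≤? 6)} → (d + (3 + i)) % n ≡ y % n → T (fwd d)
    forwards {d≤6 = d≤6} = %⇒offset n (3 + i) y (≤-<-trans (toWitness d≤6) 6<n)
    backwards : ∀ {d} {d≤6 : True (d ≤? 6)} → (3 + i) % n ≡ (d + y) % n → T (bwd d)
    backwards {d≤6 = d≤6} e = %⇒offset n y (3 + i) (≤-<-trans (toWitness d≤6) 6<n) (sym e)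
    left : ∀ b {b′} → T b → T (b ∨ b′)
    left b = from (T-∨ {b}) ∘ inj₁
    right : ∀ b {b′} → T b′ → T (b ∨ b′)
    right b = from (T-∨ {b}) ∘ inj₂

  module _ (C : Subset n) where

    -- The periodic extension of the code, so that windows may run past `n`.
    code : ℕ → Bool
    code i = lookup C (i mod n)

    code-cong : ∀ {x y} → x % n ≡ y % n → code x ≡ code y
    code-cong x≡y = cong (lookup C) (mod-cong n x≡y)

    Hits : List ℕ → ℕ → Set
    Hits ks i = Any (λ k → T (code (k + i))) ks

    -- A codeword reached through some `k` in `ks` but not in `ls` would be a hit of `ks ∖ ls`.
    meets-∖ : ∀ ks ls {i y} → ¬ Hits (ks ∖ ls) i → T (code y) → Meets ks i y → Meets ls i y
    meets-∖ ks ls {i} {y} miss cy m with find m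
    ... | k , k∈ks , k+i≡y with _∈?_ _≟_ k ls
    ... | yes k∈ls = lose k∈ls k+i≡y
    ... | no  k∉ls = ⊥-elim (miss (lose (∈-filter⁺ _ k∈ks k∉ls) (subst T (sym (code-cong k+i≡y)) cy)))

    shift : ∀ d k i → (d + k) + i ≡ k + (d + i)
    shift d k i = trans (cong (_+ i) (+-comm d k)) (+-assoc k d i)

    meets-shift : ∀ d i y → Meets ball (d + i) y ⇔ Meets (map (d +_) ball) i y
    meets-shift d i y = mk⇔
      (λ m → map⁺ (Any.map (λ {k} → trans (cong (_% n) (shift d k i))) m))
      (λ m → Any.map (λ {k} → trans (cong (_% n) (sym (shift d k i)))) (map⁻ m))

    -- The two balls differ only in the translate of `ballDifference d`; a codeword in one ball and
    -- outside that translate lies in the other.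
    I-agree : ∀ d i → ¬ Hits (ballDifference d) i →
              I C ((3 + i) mod n) ≡ I C ((3 + (d + i)) mod n)
    I-agree d i miss = tabulate-cong λ w →
      subst (λ w → adj? n u w ∧ lookup C w ≡ adj? n v w ∧ lookup C w) (mod-toℕ n w)
            (⇔→≡ (mk⇔ (along (toℕ w) (there⇒ (toℕ w))) (along (toℕ w) (back⇒ (toℕ w)))))
      where
      u = (3 + i) mod n
      v = (3 + (d + i)) mod n
      there⇒ : ∀ y → T (code y) → T (adj? n u (y mod n)) → T (adj? n v (y mod n))
      there⇒ y cy = ball⇒adj (d + i) y ∘ from (meets-shift d i y)
        ∘ meets-∖ ball (map (d +_) ball) (miss ∘ ++⁺ˡ) cy ∘ adj⇒ball i y
      back⇒ : ∀ y → T (code y) → T (adj? n v (y mod n)) → T (adj? n u (y mod n))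
      back⇒ y cy = ball⇒adj i y
        ∘ meets-∖ (map (d +_) ball) ball (miss ∘ ++⁺ʳ (ball ∖ map (d +_) ball)) cy
        ∘ to (meets-shift d i y) ∘ adj⇒ball (d + i) y
      along : ∀ y {a b} → (T (code y) → T a → T b) → a ∧ code y ≡ true → b ∧ code y ≡ true
      along y f eq with to T-∧ (from T-≡ eq)
      ... | ta , cy = to T-≡ (from T-∧ (f cy ta , cy))

    word-cong : ∀ m {x y} → x % n ≡ y % n → word code m x ≡ word code m y
    word-cong zero    x≡y = refl
    word-cong (suc m) x≡y = cong₂ _∷_ (code-cong x≡y) (word-cong m (%-+-congˡ n 1 x≡y))

    module _ (identifying : IsIdentifying n C) where

      covered : ∀ i → Hits ball i
      covered i with proj₁ identifying ((3 + i) mod n)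
      ... | w , w∈I with to T-∧ (from T-≡ (trans (sym (lookup∘tabulate _ w)) ([]=⇒lookup w∈I)))
      ... | adj , cw = Any.map
        (λ k+i≡w → subst T (trans (cong (lookup C) (sym (mod-toℕ n w))) (code-cong (sym k+i≡w))) cw)
        (adj⇒ball i (toℕ w) (subst (T ∘ adj? n ((3 + i) mod n)) (sym (mod-toℕ n w)) adj))

      separated : ∀ d i .{{_ : NonZero d}} → d ≤ 6 → Hits (ballDifference d) i
      separated d i d≤6 with any? (λ k → T? (code (k + i))) (ballDifference d)
      ... | yes hit  = hit
      ... | no  miss = ⊥-elim (proj₂ identifying _ _ distinct (I-agree d i miss))
        where
        distinct : (3 + i) mod n ≢ (3 + (d + i)) mod n
        -- As `d ≤ 6 < n`, the nonzero `d` is its own residue.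
        distinct u≡v = ≢-nonZero⁻¹ d (begin
          d     ≡⟨ m<n⇒m%n≡m (≤-<-trans d≤6 6<n) ⟨
          d % n ≡⟨ %-+-cancelˡ n (3 + i) {0} {d} 3+i≡3+i+d ⟨
          0 % n ≡⟨ m<n⇒m%n≡m (≤-<-trans z≤n 6<n) ⟩
          0     ∎)
          where
          open ≡-Reasoning
          3+i≡3+i+d : (3 + i + 0) % n ≡ (3 + i + d) % n
          3+i≡3+i+d = begin
            (3 + i + 0) % n           ≡⟨ cong (_% n) (+-identityʳ (3 + i)) ⟩
            (3 + i) % n               ≡⟨ toℕ-mod n (3 + i) ⟨
            toℕ ((3 + i) mod n)       ≡⟨ cong toℕ u≡v ⟩
            toℕ ((3 + (d + i)) mod n) ≡⟨ toℕ-mod n (3 + (d + i)) ⟩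
            (3 + (d + i)) % n         ≡⟨ cong (λ x → (3 + x) % n) (+-comm d i) ⟩
            (3 + i + d) % n           ∎

      -- The entries of `supports` are the values of `ball` and `ballDifference d`, and for each
      -- literal `k` in them letter `k` of the window evaluates to `code (k + i)`.
      word-admissible : ∀ i → T (admissible (word code 13 i))
      word-admissible i = all⁻ (any (bit (word code 13 i))) {xs = supports}
        ( any⁺ (λ k → code (k + i)) (covered i)
        ∷ separate 1 (s≤s z≤n)
        ∷ separate 2 (s≤s (s≤s z≤n))
        ∷ separate 3 (s≤s (s≤s (s≤s z≤n)))
        ∷ separate 4 (s≤s (s≤s (s≤s (s≤s z≤n))))
        ∷ separate 6 ≤-refl
        ∷ [])
        where
        separate = λ d .{{_ : NonZero d}} (d≤6 : d ≤ 6) →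
          any⁺ (λ k → code (k + i)) (separated d i d≤6)

      -- The potential along the cyclic word

      module _ (t : Trie ℕ 12) (verified : T (verify t)) where

        φ penalties : ℕ → ℕ
        inside : ℕ → Bool
        φ i = at t (word code 12 i)
        inside i = periodic₁₀ (word code 10 i)
        penalties i = penalty (inside i) (inside (suc i))

        -- The prefix and the tail of the window at `i` evaluate to the 12-letter words at `i` and
        -- `suc i`, which turns the tabulated check into one about `φ`.
        checked : ∀ i → T (56 + penalties i + φ (suc i) ≤ᵇ 154 * value (code i) + φ i)
                      × T (if inside i ∧ inside (1 + i) ∧ inside (2 + i) ∧ inside (3 + i)
                           then 154 * value (code i) + φ i ≤ᵇ 56 + φ (suc i) else true)
        checked i = to T-∧ (if-then-sound (admissible (word code 13 i))
          (every-sound 13 (check t) verified (word code 13 i)) (word-admissible i))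

        φ-cyclic : φ n ≡ φ 0
        φ-cyclic = cong (at t) (word-cong 12 (trans (n%n≡0 n) (sym (m<n⇒m%n≡m (≤-<-trans z≤n 6<n)))))

        φ-rotate : ∑[ i < n ] φ (suc (toℕ i)) ≡ ∑[ i < n ] φ (toℕ i)
        φ-rotate = +-cancelˡ-≡ (φ 0) _ _ (begin
          φ 0 + ∑[ i < n ] φ (suc (toℕ i)) ≡⟨ sum-rotate n φ ⟩
          ∑[ i < n ] φ (toℕ i) + φ n       ≡⟨ +-comm _ (φ n) ⟩
          φ n + ∑[ i < n ] φ (toℕ i)       ≡⟨ cong (_+ ∑[ i < n ] φ (toℕ i)) φ-cyclic ⟩
          φ 0 + ∑[ i < n ] φ (toℕ i)       ∎)
          where open ≡-Reasoning

        sum-weight : ∑[ i < n ] (154 * value (code (toℕ i))) ≡ 154 * ∣ C ∣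
        sum-weight = begin
          ∑[ i < n ] (154 * value (code (toℕ i))) ≡⟨ *-distribˡ-sum {n} 154 (λ i → value (code (toℕ i))) ⟨
          154 * ∑[ i < n ] value (code (toℕ i))   ≡⟨ cong (154 *_) (sum-cong-≗ {n} (λ i → cong (value ∘ lookup C) (mod-toℕ n i))) ⟩
          154 * ∑[ i < n ] value (lookup C i)     ≡⟨ cong (154 *_) (∣∣-sum C) ⟨
          154 * ∣ C ∣                             ∎
          where open ≡-Reasoning

        weight-lower : n * 56 + ∑[ i < n ] penalties (toℕ i) ≤ 154 * ∣ C ∣
        weight-lower = begin
          n * 56 + ∑[ i < n ] penalties (toℕ i)        ≡⟨ cong (_+ ∑[ i < n ] penalties (toℕ i)) (sum-const n 56) ⟨
          ∑[ i < n ] 56 + ∑[ i < n ] penalties (toℕ i) ≡⟨ ∑-distrib-+ {n} (λ _ → 56) (λ i → penalties (toℕ i)) ⟨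
          ∑[ i < n ] (56 + penalties (toℕ i))          ≤⟨ sum-cancel-≤ {n} _ _ (λ i → φ (suc (toℕ i))) (λ i → φ (toℕ i)) φ-rotate
              (λ i → ≤ᵇ⇒≤ _ _ (proj₁ (checked (toℕ i)))) ⟩
          ∑[ i < n ] (154 * value (code (toℕ i))) ≡⟨ sum-weight ⟩
          154 * ∣ C ∣ ∎
          where open ≤-Reasoning

        -- Inside the periodic word the second half of `checked` reverses the inequality without
        -- penalty, and the potential cancels again.
        periodic⇒weight-upper : (∀ i → T (inside i)) → 154 * ∣ C ∣ ≤ n * 56
        periodic⇒weight-upper always = begin
          154 * ∣ C ∣                             ≡⟨ sum-weight ⟨
          ∑[ i < n ] (154 * value (code (toℕ i))) ≤⟨ sum-cancel-≤ {n} _ _ (λ i → φ (toℕ i)) (λ i → φ (suc (toℕ i))) (sym φ-rotate)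
              (λ i → ≤ᵇ⇒≤ _ _ (if-then-sound _ (proj₂ (checked (toℕ i))) (four (toℕ i)))) ⟩
          ∑[ i < n ] 56 ≡⟨ sum-const n 56 ⟩
          n * 56 ∎
          where
          open ≤-Reasoning
          four : ∀ i → T (inside i ∧ inside (1 + i) ∧ inside (2 + i) ∧ inside (3 + i))
          four i = from (T-∧ {inside i}) (always i , from (T-∧ {inside (1 + i)}) (always (1 + i)
                     , from (T-∧ {inside (2 + i)}) (always (2 + i) , always (3 + i))))

        inside-cong : ∀ {x y} → x % n ≡ y % n → inside x ≡ inside y
        inside-cong = cong periodic₁₀ ∘ word-cong 10

        slack⇒tight : ∀ p → p ≤ 42 → p < n → 154 * ∣ C ∣ ≤ n * 56 + p → 154 * ∣ C ∣ ≡ n * 56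
        slack⇒tight p p≤42 p<n C≤ = dichotomy (T? (inside 0))
          where
          total : ∑[ i < n ] penalties (toℕ i) ≤ p
          total = +-cancelˡ-≤ (n * 56) _ _ (≤-trans weight-lower C≤)
          stay : ∀ i → T (inside i) → T (inside (suc i))
          -- The sum runs over residues only, so the penalty at `i` is first moved to `i mod n`.
          stay i = penalty≤42⇒stays (inside i) (≤-trans (≤-reflexive same) (≤-trans (term≤sum (penalties ∘ toℕ) (i mod n)) (≤-trans total p≤42)))
            where
            i≡ : i % n ≡ toℕ (i mod n) % n
            i≡ = trans (sym (m%n%n≡m%n i n)) (cong (_% n) (sym (toℕ-mod n i)))
            same : penalties i ≡ penalties (toℕ (i mod n))
            same = cong₂ penalty (inside-cong i≡) (inside-cong (%-+-congˡ n 1 i≡))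
          stays : ∀ k i → T (inside i) → T (inside (k + i))
          stays zero    i zi = zi
          stays (suc k) i zi = stay (k + i) (stays k i zi)
          dichotomy : _ → _
          dichotomy (yes z₀) = ≤-antisym
            (periodic⇒weight-upper λ i → subst (T ∘ inside) (+-identityʳ i) (stays i 0 z₀))
            (≤-trans (m≤m+n (n * 56) _) weight-lower)
          dichotomy (no ¬z₀) = ⊥-elim (<-irrefl refl (begin-strict
            p                            <⟨ p<n ⟩
            n                            ≡⟨ *-identityʳ n ⟨
            n * 1                        ≡⟨ sum-const n 1 ⟨
            ∑[ i < n ] 1                 ≡⟨ sum-cong-≗ {n} (λ i → sym (outside⇒penalty≡1 (inside (toℕ i)) (outside (toℕ i)))) ⟩
            ∑[ i < n ] penalties (toℕ i) ≤⟨ total ⟩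
            p                            ∎))
            where
            open ≤-Reasoning
            outside : ∀ i → ¬ T (inside i)
            -- Staying inside from `i` onwards reaches position `i * n`, which is position 0 again.
            outside i zi = ¬z₀ (subst T (inside-cong around) (stays (i * n ∸ i) i zi))
              where
              around : (i * n ∸ i + i) % n ≡ 0 % n
              around = trans (cong (_% n) (m∸n+n≡m (m≤m*n i n))) (trans (m*n%n≡0 i n) (sym (m*n%n≡0 0 n)))

        -- p bounds 154 ∣ C ∣ − 56 n when ∣ C ∣ ≤ ⌈ 4 n / 11 ⌉ = s + 4 q.
        size-bound : ∀ q r p → let s = (4 * r + 10) / 11 in
                     n ≡ 11 * q + r → p ≤ 42 → p < n → 154 * s ≡ 56 * r + p → (4 * r) % 11 ≢ 0 →
                     ⌈ 4 * n / 11 ⌉ + 1 ≤ ∣ C ∣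
        size-bound q r p n≡ p≤42 p<n 154s≡ r≢0 = ≮⇒≥ λ C< → r≢0 (residue (slack⇒tight p p≤42 p<n (begin
          154 * ∣ C ∣                ≤⟨ *-monoʳ-≤ 154 (s≤s⁻¹ (subst (∣ C ∣ <_) (trans (+-comm _ 1) (cong suc ceiling)) C<)) ⟩
          154 * (s + 4 * q)          ≡⟨ *-distribˡ-+ 154 s (4 * q) ⟩
          154 * s + 154 * (4 * q)    ≡⟨ cong (_+ 154 * (4 * q)) 154s≡ ⟩
          56 * r + p + 154 * (4 * q) ≡⟨ expand q r p ⟩
          (11 * q + r) * 56 + p      ≡⟨ cong (λ n → n * 56 + p) n≡ ⟨
          n * 56 + p                 ∎)))
          where
          open ≤-Reasoning
          s = (4 * r + 10) / 11
          expand : ∀ q r p → 56 * r + p + 154 * (4 * q) ≡ (11 * q + r) * 56 + p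
          expand = solve-∀
          expand₄ : ∀ q r → 4 * (11 * q + r) + 10 ≡ 4 * r + 10 + 4 * q * 11
          expand₄ = solve-∀
          ceiling : ⌈ 4 * n / 11 ⌉ ≡ s + 4 * q
          ceiling = begin-equality
            (4 * n + 11 ∸ 1) / 11          ≡⟨ cong (_/ 11) (+-∸-assoc (4 * n) {11} {1} (s≤s z≤n)) ⟩
            (4 * n + 10) / 11              ≡⟨ cong (λ n → (4 * n + 10) / 11) n≡ ⟩
            (4 * (11 * q + r) + 10) / 11   ≡⟨ cong (_/ 11) (expand₄ q r) ⟩
            (4 * r + 10 + 4 * q * 11) / 11 ≡⟨ +-distrib-/-∣ʳ (4 * r + 10) (n∣m*n (4 * q)) ⟩
            s + 4 * q * 11 / 11            ≡⟨ cong (s +_) (m*n/n≡m (4 * q) 11) ⟩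
            s + 4 * q                      ∎
          regroup : ∀ q r → 4 * (11 * q + r) ≡ 4 * r + 4 * q * 11
          regroup = solve-∀
          residue : 154 * ∣ C ∣ ≡ n * 56 → (4 * r) % 11 ≡ 0
          residue eq = begin-equality
            (4 * r) % 11              ≡⟨ [m+kn]%n≡m%n (4 * r) (4 * q) 11 ⟨
            (4 * r + 4 * q * 11) % 11 ≡⟨ cong (_% 11) (regroup q r) ⟨
            (4 * (11 * q + r)) % 11   ≡⟨ cong (λ n → (4 * n) % 11) n≡ ⟨
            -- Since 154 = 14 · 11 and 56 = 14 · 4, tightness says `∣ C ∣ * 11 ≡ 4 * n`.
            (4 * n) % 11              ≡⟨ cong (_% 11) (*-cancelˡ-≡ (∣ C ∣ * 11) (4 * n) 14 (trans (left ∣ C ∣) (trans eq (right n)))) ⟨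
            (∣ C ∣ * 11) % 11         ≡⟨ m*n%n≡0 ∣ C ∣ 11 ⟩
            0                         ∎
            where
            left : ∀ m → 14 * (m * 11) ≡ 154 * m
            left = solve-∀
            right : ∀ m → m * 56 ≡ 14 * (4 * m)
            right = solve-∀

-- The three residue classes modulo 11

theorem5 : (n : ℕ) .{{_ : NonZero n}}
    → (Σ ℕ λ q → (n ≡ 11 * q + 2) × (q ≥ 5))
    ⊎ (Σ ℕ λ q → (n ≡ 11 * q + 5) × (q ≥ 3))
    ⊎ (Σ ℕ λ q → (n ≡ 11 * q + 8) × (q ≥ 1))
    → (C : Subset n) → IsIdentifying n C
    → ⌈ 4 * n / 11 ⌉ + 1 ≤ ∣ C ∣
theorem5 n residue C identifying = cases residue
  where
  large : ∀ {q} m r p {p<large : True (p <? 11 * m + r)} → n ≡ 11 * q + r → q ≥ m → p < n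
  large {q} m r p {p<large} n≡ q≥m = <-≤-trans (toWitness p<large)
    (≤-trans (+-monoˡ-≤ r (*-monoʳ-≤ 11 q≥m)) (≤-reflexive (sym n≡)))
  bound : ∀ q r p {p≤42 : True (p ≤? 42)} → 6 < n → p < n → n ≡ 11 * q + r →
          154 * ((4 * r + 10) / 11) ≡ 56 * r + p → (4 * r) % 11 ≢ 0 → ⌈ 4 * n / 11 ⌉ + 1 ≤ ∣ C ∣
  bound q r p {p≤42} 6<n p<n n≡ = size-bound 6<n C identifying
    (proj₁ verifiedPotential) (proj₂ verifiedPotential) q r p n≡ (toWitness p≤42) p<n
  cases : _ → ⌈ 4 * n / 11 ⌉ + 1 ≤ ∣ C ∣
  -- The slacks are 154 · 1 - 56 · 2 = 42, 154 · 2 - 56 · 5 = 28 and 154 · 3 - 56 · 8 = 14, below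
  -- the least values 57, 38 and 19 of `n`. The residues of `4 * r` are 8, 9 and 10.
  cases (inj₁ (q , n≡ , q≥5))        = bound q 2 42 (large 5 2 6 n≡ q≥5) (large 5 2 42 n≡ q≥5) n≡ refl (λ ())
  cases (inj₂ (inj₁ (q , n≡ , q≥3))) = bound q 5 28 (large 3 5 6 n≡ q≥3) (large 3 5 28 n≡ q≥3) n≡ refl (λ ())
  cases (inj₂ (inj₂ (q , n≡ , q≥1))) = bound q 8 14 (large 1 8 6 n≡ q≥1) (large 1 8 14 n≡ q≥1) n≡ refl (λ ())
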